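{- Let $G$ be a graph of order $n$ with $n \geq 2$, and let $\overline{G}$ be its complement. Then $$4 \leq b_{\rm g}(G)\, b_{\rm g}(\overline{G}) \leq 2n.$$
   Context: All graphs are finite, simple and undirected; the order of a graph is its number of vertices. The burning game on a graph $G$ is played by two players, Burner and Staller, in rounds $t=1,2,3,\dots$. Initially (round $0$) all vertices are unburned. Each round $t\ge 1$ consists of two phases: first, in the spreading phase, every unburned vertex having a burning neighbor starts to burn (fire spreads simultaneously, by distance one, from all burning vertices); then, in the selection phase, if unburned vertices remain, the player whose turn it is chooses one unburned vertex, which starts to burn. Burning vertices stay burning forever. The players alternate: one of them selects in the odd rounds, the other in the even rounds. The game ends in the first round in which all vertices of $G$ are burning (possibly already after the spreading phase of that round). Burner wants to minimize the number of rounds and Staller wants to maximize it. If both play optimally, the number of rounds is denoted $b_{\rm g}(G)$ (the game burning number) when Burner makes the first move (selects in round 1). -}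

module Defs where

open import Data.Bool.Base using (if_then_else_)
open import Data.Fin.Base using (Fin)
import Data.Fin.Properties as Fin
open import Data.Fin.Subset using (Subset; _∉_; _⊂_; _∪_; ∁; ⁅_⁆; ⊥; ∣_∣)
open import Data.Fin.Subset.Properties
  using (_∈?_; nonempty?; p⊆p∪q; x∈p∪q⁺; x∈⁅x⁆; x∈p⇒∣p-x∣<∣p∣; p⊂q⇒∣p∣<∣q∣; p⊂q⇒∁p⊃∁q; ∣p∣≤n)
open import Data.List.Base using (List; []; _∷_; allFin; filter; map)
open import Data.List.Extrema.Nat using (min; max)
open import Data.List.Properties using (map-cong-local)
import Data.List.Relation.Unary.All as All
open import Data.List.Relation.Unary.All.Properties using (all-filter)
open import Data.Nat.Base using (ℕ; zero; suc; _≤_)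
import Data.Nat.Properties as ℕ
open import Data.Product.Base using (_×_; _,_)
open import Data.Sum.Base using (inj₂)
open import Data.Vec.Base using (tabulate)
open import Level using (0ℓ)
open import Relation.Binary.Core using (Rel)
open import Relation.Binary.Definitions using (Decidable; Irreflexive; Symmetric)
open import Relation.Binary.PropositionalEquality using (_≡_; _≢_; refl; sym; cong)
open import Relation.Nullary using (¬_; does; yes; no; ¬?; _×-dec_; contradiction)

-- Finite simple undirected graphs of order n, on the vertex set Fin n.

record Graph (n : ℕ) : Set₁ where
  field
    _~_      : Rel (Fin n) 0ℓ
    _~?_     : Decidable _~_
    ~-sym    : Symmetric _~_
    ~-irrefl : Irreflexive _≡_ _~_

complement : ∀ {n} → Graph n → Graph n
complement G = record
  { _~_      = λ u v → u ≢ v × ¬ (u ~ v)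
  ; _~?_     = λ u v → ¬? (u Fin.≟ v) ×-dec ¬? (u ~? v)
  ; ~-sym    = λ (u≢v , u≁v) → (λ v≡u → u≢v (sym v≡u)) , (λ v~u → u≁v (~-sym v~u))
  ; ~-irrefl = λ u≡v (u≢v , _) → u≢v u≡v
  }
  where open Graph G

data Player : Set where
  burner staller : Player

opponent : Player → Player
opponent burner  = staller
opponent staller = burner

-- With [] there is nothing left to select: the spreading phase has ended the
-- game, and no further rounds are played.

optimal : Player → List ℕ → ℕ
optimal _       []       = 0
optimal burner  (x ∷ xs) = min x xs
optimal staller (x ∷ xs) = max x xs

module _ {n : ℕ} (G : Graph n) where
  open Graph G

  spread : Subset n → Subset n
  spread S = S ∪ tabulate (λ v → does (Fin.any? (λ u → (u ∈? S) ×-dec (u ~? v))))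

  unburned : Subset n → List (Fin n)
  unburned S = filter (λ v → ¬? (v ∈? S)) (allFin n)

  -- The burning sets that can result from the next round.

  afterSelection : Subset n → Fin n → Subset n
  afterSelection S v = spread S ∪ ⁅ v ⁆

  -- Minimax value of the game truncated after m more rounds: S is the set of
  -- burning vertices at the end of the previous round, and the given player
  -- selects in the next round.

  truncated : ℕ → Player → Subset n → ℕ
  truncated zero    _ _ = 0
  truncated (suc m) p S =
    if does (nonempty? (∁ S))
      then suc (optimal p (map (λ v → truncated m (opponent p) (afterSelection S v))
                               (unburned (spread S))))
      else 0

  -- Every round burns a new vertex, so truncating after n rounds cuts nothing
  -- off; rounds-minimax below is the resulting recursion without truncation.

  rounds : Player → Subset n → ℕ
  rounds = truncated n

  gameBurningNumber : ℕ
  gameBurningNumber = rounds burner ⊥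

  afterSelection-< : ∀ {S v} m → v ∉ spread S → ∣ ∁ S ∣ ≤ suc m →
                     ∣ ∁ (afterSelection S v) ∣ ≤ m
  afterSelection-< {S} {v} m v∉ ∣∁S∣≤ =
    ℕ.≤-pred (ℕ.≤-trans (p⊂q⇒∣p∣<∣q∣ (p⊂q⇒∁p⊃∁q S⊂)) ∣∁S∣≤)
    where
    S⊂ : S ⊂ afterSelection S v
    S⊂ = (λ x∈S → p⊆p∪q _ (p⊆p∪q _ x∈S))
       , v , x∈p∪q⁺ (inj₂ (x∈⁅x⁆ v)) , λ v∈S → v∉ (p⊆p∪q _ v∈S)

  truncated-stable : ∀ m p S → ∣ ∁ S ∣ ≤ m → truncated (suc m) p S ≡ truncated m p S
  truncated-stable zero p S ∣∁S∣≤0 with nonempty? (∁ S)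
  ... | yes (x , x∈∁S) = contradiction (ℕ.≤-trans (x∈p⇒∣p-x∣<∣p∣ x∈∁S) ∣∁S∣≤0) λ ()
  ... | no _ = refl
  truncated-stable (suc m) p S ∣∁S∣≤ =
    cong (λ xs → if does (nonempty? (∁ S)) then suc (optimal p xs) else 0)
      (map-cong-local (All.map
        (λ v∉ → truncated-stable m (opponent p) _ (afterSelection-< m v∉ ∣∁S∣≤))
        (all-filter (λ v → ¬? (v ∈? spread S)) (allFin n))))

  rounds-minimax : ∀ p S → rounds p S ≡
    (if does (nonempty? (∁ S))
      then suc (optimal p (map (λ v → rounds (opponent p) (afterSelection S v))
                               (unburned (spread S))))
      else 0)
  rounds-minimax p S = sym (truncated-stable n p S (∣p∣≤n (∁ S)))

{-# OPTIONS --safe #-}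
-- Let G and H be graphs on the same n vertices that together cover all pairs of
-- distinct vertices, such as a graph and its complement, in either order.  If
-- the maximum degree of G is at least that of H, then Burner finishes on G
-- within 3 rounds by starting at a vertex v of maximum degree: a vertex u that
-- survives the third spreading phase is H-adjacent to v and to all G-neighbours
-- of v, so its H-degree exceeds the G-degree of v.
--
-- If moreover every vertex of H has two H-neighbours, then on H an average of
-- two vertices per round burn, however the game is played, because a round in
-- which the fire does not spread is followed by one in which it reaches two new
-- vertices; so H burns within ⌈n/2⌉ rounds.  Otherwise Burner starts on G at a
-- vertex with at most one H-neighbour and finishes within 2 rounds, while H
-- burns within n rounds.
module Submission where

open import Defs
open import Data.Fin.Base using (Fin; zero; suc; fromℕ<)
import Data.Fin.Properties as Fin
open import Data.Fin.Subset using (Subset; _∈_; _∉_; _⊆_; _⊂_; _∪_; ∁; ⁅_⁆; ⊥; ∣_∣; Nonempty)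
open import Data.Fin.Subset.Properties
open import Data.List.Base using (List; []; _∷_; allFin; map)
open import Data.List.Extrema.Nat
  using (min≤v⁺; v≤min⁺; max≤v⁺; v≤max⁺; argmax; f[xs]≤f[argmax])
open import Data.List.Membership.Propositional using () renaming (_∈_ to _∈ˡ_)
open import Data.List.Membership.Propositional.Properties using (∈-allFin; ∈-filter⁺; ∈-map⁺)
open import Data.List.Relation.Unary.All as All using (All; []; _∷_)
import Data.List.Relation.Unary.All.Properties as All
open import Data.List.Relation.Unary.Any as Any using (Any; here; there)
import Data.List.Relation.Unary.Any.Properties as Any
open import Data.Nat using (ℕ; zero; suc; pred; _≤_; _<_; z≤n; s≤s; _*_; ⌊_/2⌋; ⌈_/2⌉)
import Data.Nat.Properties as ℕ
open import Data.Product using (∃-syntax; _×_; _,_; proj₁; proj₂)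
open import Data.Sum using (_⊎_; inj₁; inj₂; swap)
open import Data.Vec.Base using (tabulate)
open import Data.Vec.Properties using (lookup∘tabulate; []=⇒lookup; lookup⇒[]=)
open import Function using (_∘_)
open import Relation.Binary.PropositionalEquality
  using (_≡_; _≢_; refl; sym; trans; subst; ≢-sym)
open import Relation.Nullary
  using (Dec; does; yes; no; ¬_; ¬?; _×-dec_; contradiction)
open import Relation.Nullary.Decidable using (dec-true)
open import Relation.Unary using (Pred; Decidable)

private variable
  n k : ℕ
  xs : List ℕ
  S T : Subset n
  u v w : Fin n

-- Subsets given by decidable predicates, and strict growth.

module _ {P : Fin n → Set} (P? : Decidable P) where

  ∈-tabulate⁺ : P v → v ∈ tabulate (does ∘ P?)
  ∈-tabulate⁺ {v} Pv =
    lookup⇒[]= v _ (trans (lookup∘tabulate (does ∘ P?) v) (dec-true (P? v) Pv))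

  ∈-tabulate⁻ : v ∈ tabulate (does ∘ P?) → P v
  ∈-tabulate⁻ {v} v∈ with P? v | trans (sym (lookup∘tabulate (does ∘ P?) v)) ([]=⇒lookup v∈)
  ... | yes Pv | _  = Pv
  ... | no _   | ()

∉∪ : v ∉ S → v ∉ T → v ∉ S ∪ T
∉∪ v∉S v∉T v∈ with x∈p∪q⁻ _ _ v∈
... | inj₁ v∈S = v∉S v∈S
... | inj₂ v∈T = v∉T v∈T

∪-⊆ : S ⊆ T → v ∈ T → S ∪ ⁅ v ⁆ ⊆ T
∪-⊆ {v = v} S⊆T v∈T w∈ with x∈p∪q⁻ _ _ w∈
... | inj₁ w∈S = S⊆T w∈S
... | inj₂ w∈v rewrite x∈⁅y⁆⇒x≡y v w∈v = v∈T

S⊂S∪⁅v⁆ : v ∉ S → S ⊂ S ∪ ⁅ v ⁆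
S⊂S∪⁅v⁆ {v = v} v∉S = p⊆p∪q _ , v , q⊆p∪q _ _ (x∈⁅x⁆ v) , v∉S

⊂⇒∣∁∣> : S ⊂ T → ∣ ∁ T ∣ < ∣ ∁ S ∣
⊂⇒∣∁∣> = p⊂q⇒∣p∣<∣q∣ ∘ p⊂q⇒∁p⊃∁q

¬Nonempty⇒∈ : ¬ Nonempty (∁ S) → v ∈ S
¬Nonempty⇒∈ full = x∉∁p⇒x∈p (λ v∈∁S → full (_ , v∈∁S))

-- Bounds on a single optimal choice.

optimal-≤ : ∀ p → All (_≤ k) xs → optimal p xs ≤ k
optimal-≤ _       []                      = z≤n
optimal-≤ burner  (_∷_ {x = x} {xs} x≤ _) = min≤v⁺ x xs (inj₁ x≤)
optimal-≤ staller (x≤ ∷ xs≤)              = max≤v⁺ x≤ xs≤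

optimal-burner-≤ : Any (_≤ k) xs → optimal burner xs ≤ k
optimal-burner-≤ (here {x} {xs} x≤)   = min≤v⁺ x xs (inj₁ x≤)
optimal-burner-≤ (there {x} {xs} xs≤) = min≤v⁺ x xs (inj₂ xs≤)

-- The member `x` rules out the empty list, on which `optimal` is 0.
≤-optimal : ∀ p {x} → x ∈ˡ xs → All (k ≤_) xs → k ≤ optimal p xs
≤-optimal burner  _ (≤x ∷ ≤xs)              = v≤min⁺ ≤x ≤xs
≤-optimal staller _ (_∷_ {x = x} {xs} ≤x _) = v≤max⁺ x xs (inj₁ ≤x)

module _ (G : Graph n) where
  open Graph G

  private
    -- Repeats the decision procedure inside `spread`, so that the `tabulate` lemmas apply to it.
    Reached? : (S : Subset n) → Decidable (λ v → ∃[ u ] u ∈ S × u ~ v)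
    Reached? S v = Fin.any? (λ u → (u ∈? S) ×-dec (u ~? v))

  S⊆spread : S ⊆ spread G S
  S⊆spread = p⊆p∪q _

  ∈-spread⁺ : u ∈ S → u ~ v → v ∈ spread G S
  ∈-spread⁺ {S = S} u∈S u~v = q⊆p∪q _ _ (∈-tabulate⁺ (Reached? S) (_ , u∈S , u~v))

  spread-⊥ : v ∉ spread G ⊥
  spread-⊥ = ∉∪ ∉⊥ (λ v∈ → ∉⊥ (proj₁ (proj₂ (∈-tabulate⁻ (Reached? ⊥) v∈))))

  spread⊆after : spread G S ⊆ afterSelection G S v
  spread⊆after = p⊆p∪q _

  ∣∁after∣<∣∁spread∣ : ∀ S → v ∉ spread G S →
                       ∣ ∁ (afterSelection G S v) ∣ < ∣ ∁ (spread G S) ∣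
  ∣∁after∣<∣∁spread∣ S v∉ = ⊂⇒∣∁∣> (S⊂S∪⁅v⁆ {S = spread G S} v∉)

  v∈after : v ∈ afterSelection G S v
  v∈after {v} = q⊆p∪q _ _ (x∈⁅x⁆ v)

  ∈-unburned : v ∉ S → v ∈ˡ unburned G S
  ∈-unburned {v} {S} v∉S = ∈-filter⁺ (λ v → ¬? (v ∈? S)) (∈-allFin v) v∉S

  private
    unburned-map⁺ : {Q : ℕ → Set} {f : Fin n → ℕ} →
                    (∀ v → v ∉ S → Q (f v)) → All Q (map f (unburned G S))
    unburned-map⁺ {S} h =
      All.map⁺ (All.map (h _) (All.all-filter (λ v → ¬? (v ∈? S)) (allFin n)))

  -- Bounds on the truncated value from one round of play.

  truncated-full : ∀ m p S → ¬ Nonempty (∁ S) → truncated G m p S ≡ 0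
  truncated-full zero _ _ _ = refl
  truncated-full (suc m) p S full with nonempty? (∁ S)
  ... | yes ne = contradiction ne full
  ... | no _   = refl

  -- Writing the next depth as `pred m` allows use at a variable depth such as `n`; depth 0 has
  -- value 0 anyway.
  truncated-≤ : ∀ m p S → (∀ v → v ∉ spread G S →
                  truncated G (pred m) (opponent p) (afterSelection G S v) ≤ k) →
                truncated G m p S ≤ suc k
  truncated-≤ zero _ _ _ = z≤n
  truncated-≤ (suc m) p S bound with nonempty? (∁ S)
  ... | yes _ = s≤s (optimal-≤ p (unburned-map⁺ bound))
  ... | no _  = z≤n

  truncated-burner-≤ : ∀ m S → v ∉ spread G S →
                       truncated G (pred m) staller (afterSelection G S v) ≤ k →
                       truncated G m burner S ≤ suc k
  truncated-burner-≤ zero _ _ _ = z≤n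
  truncated-burner-≤ (suc m) S v∉ bound with nonempty? (∁ S)
  ... | yes _ = s≤s (optimal-burner-≤
                  (Any.map⁺ (Any.map (λ { refl → bound }) (∈-unburned v∉))))
  ... | no _  = z≤n

  ≤-truncated : ∀ m p S → 0 < m → w ∉ spread G S → (∀ v → v ∉ spread G S →
                  k ≤ truncated G (pred m) (opponent p) (afterSelection G S v)) →
                suc k ≤ truncated G m p S
  ≤-truncated (suc m) p S _ w∉ bound with nonempty? (∁ S)
  ... | yes _   = s≤s (≤-optimal p (∈-map⁺ _ (∈-unburned w∉)) (unburned-map⁺ bound))
  ... | no full = contradiction (S⊆spread (¬Nonempty⇒∈ full)) w∉

  0<truncated : ∀ m p S → 0 < m → v ∉ S → 0 < truncated G m p S
  0<truncated (suc m) p S _ v∉S with nonempty? (∁ S)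
  ... | yes _   = s≤s z≤n
  ... | no full = contradiction (¬Nonempty⇒∈ full) v∉S

  truncated-≤-depth : ∀ m p S → truncated G m p S ≤ m
  truncated-≤-depth zero    p S = z≤n
  truncated-≤-depth (suc m) p S =
    truncated-≤ (suc m) p S (λ v _ → truncated-≤-depth m (opponent p) _)

  -- Graphs in which every vertex has two neighbours.

  TwoNeighbours : Pred (Fin n) _
  TwoNeighbours v = ∃[ x ] ∃[ y ] x ≢ y × v ~ x × v ~ y

  twoNeighbours? : Decidable TwoNeighbours
  twoNeighbours? v = Fin.any? λ x → Fin.any? λ y →
    ¬? (x Fin.≟ y) ×-dec ((v ~? x) ×-dec (v ~? y))

  neighbours : Fin n → Subset n
  neighbours v = tabulate (λ u → does (v ~? u))

  module _ (two : ∀ v → TwoNeighbours v) where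

    truncated-≤-half : ∀ m p S → truncated G m p S ≤ ⌈ ∣ ∁ S ∣ /2⌉
    -- The position left by a stalled round. Two vertices are about to catch fire, so the next round
    -- burns three with its selection; this surplus turns the ceiling into a floor.
    truncated-≤-half-active : ∀ m p S {v x y} → v ∈ S → x ≢ y → v ~ x → v ~ y →
                              x ∉ S → y ∉ S → truncated G m p S ≤ ⌊ ∣ ∁ S ∣ /2⌋

    truncated-≤-half zero p S = z≤n
    truncated-≤-half m@(suc m-1) p S
      with Fin.any? (λ x → (x ∈? spread G S) ×-dec ¬? (x ∈? S))
    ... | yes (x , x∈ , x∉) =
      ℕ.≤-trans
        (truncated-≤ m p S λ v v∉ →
          ℕ.≤-trans (truncated-≤-half m-1 (opponent p) (afterSelection G S v))
            -- By definition `⌈ a /2⌉` is `⌊ suc a /2⌋`, so the strict drop caused by the selection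
            -- turns the ceiling into a floor.
            (ℕ.⌊n/2⌋-mono (∣∁after∣<∣∁spread∣ S v∉)))
        (ℕ.⌈n/2⌉-mono (⊂⇒∣∁∣> {S = S} {spread G S} (S⊆spread , x , x∈ , x∉)))
    ... | no still = stalled (nonempty? (∁ S))
      where
      -- As the fire did not spread, a burning neighbour of `v` would lie in `S` already and would
      -- have ignited `v`.
      fresh : ∀ {v x} → v ∉ spread G S → v ~ x → x ∉ afterSelection G S v
      fresh {v} {x} v∉ v~x = ∉∪
        (λ x∈ → still (x , x∈ , λ x∈S → v∉ (∈-spread⁺ x∈S (~-sym v~x))))
        (λ x∈v → ~-irrefl (sym (x∈⁅y⁆⇒x≡y v x∈v)) v~x)
      suc⌊pred/2⌋ : ∀ {c} → 0 < c → suc ⌊ pred c /2⌋ ≤ ⌈ c /2⌉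
      suc⌊pred/2⌋ (s≤s _) = ℕ.≤-refl
      stalled : Dec (Nonempty (∁ S)) → truncated G m p S ≤ ⌈ ∣ ∁ S ∣ /2⌉
      stalled (no full) = ℕ.≤-trans (ℕ.≤-reflexive (truncated-full m p S full)) z≤n
      stalled (yes (u , u∈∁S)) =
        ℕ.≤-trans
          (truncated-≤ m p S λ v v∉ → let x , y , x≢y , v~x , v~y = two v in
            ℕ.≤-trans
              (truncated-≤-half-active m-1 (opponent p) (afterSelection G S v)
                (v∈after {S = S}) x≢y v~x v~y (fresh v∉ v~x) (fresh v∉ v~y))
              (ℕ.⌊n/2⌋-mono (ℕ.<⇒≤pred
                (ℕ.<-≤-trans (∣∁after∣<∣∁spread∣ S v∉)
                  (p⊆q⇒∣p∣≤∣q∣ (p⊆q⇒∁p⊇∁q (S⊆spread {S = S})))))))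
          (suc⌊pred/2⌋ (ℕ.≤-trans (s≤s z≤n) (x∈p⇒∣p-x∣<∣p∣ u∈∁S)))

    truncated-≤-half-active zero p S _ _ _ _ _ _ = z≤n
    truncated-≤-half-active m@(suc m-1) p S {v} {x} {y} v∈S x≢y v~x v~y x∉S y∉S =
      ℕ.≤-trans
        (truncated-≤ m p S λ w w∉ →
          ℕ.≤-trans (truncated-≤-half m-1 (opponent p) (afterSelection G S w))
            (ℕ.⌊n/2⌋-mono (∣∁after∣<∣∁spread∣ S w∉)))
        -- Spreading alone burns both `x` and `y`: adding `x` first and `y` later gives two strict
        -- inclusions.
        (ℕ.⌊n/2⌋-mono (ℕ.≤-trans (s≤s (⊂⇒∣∁∣> {S = S ∪ ⁅ x ⁆} {spread G S} S∪x⊂))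
          (⊂⇒∣∁∣> {S = S} (S⊂S∪⁅v⁆ x∉S))))
      where
      S∪x⊂ : S ∪ ⁅ x ⁆ ⊂ spread G S
      S∪x⊂ = ∪-⊆ (S⊆spread {S = S}) (∈-spread⁺ v∈S v~x)
           , y , ∈-spread⁺ v∈S v~y , ∉∪ y∉S (x≢y⇒x∉⁅y⁆ (≢-sym x≢y))

  -- Nothing burns at the start, so round 1 burns only the selected vertex and leaves another.
  2≤gameBurningNumber : 2 ≤ n → 2 ≤ gameBurningNumber G
  2≤gameBurningNumber 2≤n =
    ≤-truncated n burner ⊥ (ℕ.<⇒≤ 2≤n) (spread-⊥ {v = fromℕ< 2≤n}) λ v _ →
      let w , w≢v = other 2≤n v in
      0<truncated (pred n) staller (afterSelection G ⊥ v) (ℕ.<⇒≤pred 2≤n)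
        (∉∪ {S = spread G ⊥} spread-⊥ (x≢y⇒x∉⁅y⁆ w≢v))
    where
    other : ∀ {n} → 2 ≤ n → (v : Fin n) → ∃[ w ] w ≢ v
    other (s≤s (s≤s _)) zero    = suc zero , λ ()
    other (s≤s (s≤s _)) (suc _) = zero , λ ()

  gameBurningNumber≤n : gameBurningNumber G ≤ n
  gameBurningNumber≤n = truncated-≤-depth n burner ⊥

  gameBurningNumber≤⌈n/2⌉ : (∀ v → TwoNeighbours v) → gameBurningNumber G ≤ ⌈ n /2⌉
  gameBurningNumber≤⌈n/2⌉ two =
    ℕ.≤-trans (truncated-≤-half two n burner ⊥) (ℕ.⌈n/2⌉-mono (∣p∣≤n (∁ ⊥)))

-- Symmetric in both graphs, so their roles can be exchanged without considering a double
-- complement.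
Covering : Graph n → Graph n → Set
Covering G H = ∀ {u v} → u ≢ v → Graph._~_ G u v ⊎ Graph._~_ H u v

module _ (G H : Graph n) (cover : Covering G H) where
  private
    module G = Graph G
    module H = Graph H

  ≁⇒~ : u ≢ v → ¬ u G.~ v → u H.~ v
  ≁⇒~ u≢v u≁v with cover u≢v
  ... | inj₁ u~v = contradiction u~v u≁v
  ... | inj₂ u~v = u~v

  gameBurningNumber≤2 : ¬ TwoNeighbours H v → gameBurningNumber G ≤ 2
  gameBurningNumber≤2 {v} ¬two =
    truncated-burner-≤ G n ⊥ (spread-⊥ G) (truncated-≤ G (pred n) staller S₁ λ w w∉ →
      ℕ.≤-reflexive (truncated-full G (pred (pred n)) burner (afterSelection G S₁ w) λ (z , z∈) →
        let z∉ = x∈∁p⇒x∉p z∈ in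
        -- Staller's selection `w` and a leftover `z` would be two distinct `H`-neighbours of `v`.
        ¬two (w , z , (λ { refl → z∉ (v∈after G {S = S₁}) })
             , survivor w∉ , survivor (z∉ ∘ spread⊆after G {S = S₁}))))
    where
    S₁ : Subset n
    S₁ = afterSelection G ⊥ v
    survivor : ∀ {x} → x ∉ spread G S₁ → v H.~ x
    survivor x∉ = ≁⇒~ (λ { refl → x∉ (S⊆spread G {S = S₁} (v∈after G {S = ⊥})) })
                      (λ v~x → x∉ (∈-spread⁺ G {S = S₁} (v∈after G {S = ⊥}) v~x))

  gameBurningNumber≤3 : (∀ u → ∣ neighbours H u ∣ ≤ ∣ neighbours G v ∣) →
                        gameBurningNumber G ≤ 3
  gameBurningNumber≤3 {v} maximal =
    truncated-burner-≤ G n ⊥ (spread-⊥ G) (truncated-≤ G (pred n) staller S₁ λ w _ →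
      truncated-≤ G (pred (pred n)) burner (S₂ w) λ u u∉ →
        -- No vertex can be selected in round 3, so the game ends in its spreading phase at the
        -- latest.
        contradiction (p⊂q⇒∣p∣<∣q∣ (Nv⊂Nu {w} u∉)) (ℕ.≤⇒≯ (maximal u)))
    where
    S₁ : Subset n
    S₁ = afterSelection G ⊥ v
    S₂ : Fin n → Subset n
    S₂ = afterSelection G S₁
    Nv⊂Nu : ∀ {w u} → u ∉ spread G (S₂ w) → neighbours G v ⊂ neighbours H u
    Nv⊂Nu {w} {u} u∉ =
        (λ {x} x∈N → ∈-tabulate⁺ (u H.~?_)
          (survives (spread⊆after G {S = S₁}
            (∈-spread⁺ G {S = S₁} (v∈after G {S = ⊥}) (∈-tabulate⁻ (v G.~?_) x∈N)))))
      -- Strictness comes from `v` itself: it burns, hence is `H`-adjacent to `u`, but is not its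
      -- own neighbour.
      , v
      , ∈-tabulate⁺ (u H.~?_)
          (survives (spread⊆after G {S = S₁} (S⊆spread G {S = S₁} (v∈after G {S = ⊥}))))
      , λ v∈N → G.~-irrefl refl (∈-tabulate⁻ (v G.~?_) v∈N)
      where
      survives : ∀ {x} → x ∈ S₂ w → u H.~ x
      survives x∈ = ≁⇒~ (λ { refl → u∉ (S⊆spread G {S = S₂ w} x∈) })
                        (λ u~x → u∉ (∈-spread⁺ G {S = S₂ w} x∈ (G.~-sym u~x)))

-- Raising `n` by 2 adds 3 on the left and 4 on the right; the base cases are 3 ≤ 4 and 6 ≤ 6.
⌈n/2⌉*3≤2n : 2 ≤ n → ⌈ n /2⌉ * 3 ≤ 2 * n
⌈n/2⌉*3≤2n {n} 2≤n = subst (⌈ n /2⌉ * 3 ≤_) (ℕ.*-comm n 2) (go 2≤n)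
  where
  go : ∀ {n} → 2 ≤ n → ⌈ n /2⌉ * 3 ≤ n * 2
  go {suc zero} (s≤s ())
  go {2} _ = ℕ.n≤1+n 3
  go {3} _ = ℕ.≤-refl
  go {suc (suc n@(suc (suc _)))} _ =
    ℕ.+-mono-≤ (ℕ.n≤1+n 3) (go {n} (s≤s (s≤s z≤n)))

module _ (G H : Graph n) (cover : Covering G H) (2≤n : 2 ≤ n) where

  product-≤ : (∀ u → ∣ neighbours H u ∣ ≤ ∣ neighbours G v ∣) →
              gameBurningNumber G * gameBurningNumber H ≤ 2 * n
  product-≤ maximal with Fin.all? (twoNeighbours? H)
  ... | yes two = begin
    gameBurningNumber G * gameBurningNumber H
      ≤⟨ ℕ.*-mono-≤ (gameBurningNumber≤3 G H cover maximal) (gameBurningNumber≤⌈n/2⌉ H two) ⟩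
    3 * ⌈ n /2⌉  ≡⟨ ℕ.*-comm 3 ⌈ n /2⌉ ⟩
    ⌈ n /2⌉ * 3  ≤⟨ ⌈n/2⌉*3≤2n 2≤n ⟩
    2 * n        ∎
    where open ℕ.≤-Reasoning
  ... | no ¬two = let _ , ¬two-v = Fin.¬∀⟶∃¬ n _ (twoNeighbours? H) ¬two in
    ℕ.*-mono-≤ (gameBurningNumber≤2 G H cover ¬two-v) (gameBurningNumber≤n H)

-- The vertex `i` is the default value that `argmax` requires.
maximiser : Fin n → (f : Fin n → ℕ) → ∃[ v ] ∀ u → f u ≤ f v
maximiser {n} i f =
  argmax f i (allFin n) , λ u → All.lookup (f[xs]≤f[argmax] i (allFin n)) (∈-allFin u)

covering-complement : (G : Graph n) → Covering G (complement G)
covering-complement G {u} {v} u≢v with Graph._~?_ G u v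
... | yes u~v = inj₁ u~v
... | no u≁v  = inj₂ (u≢v , u≁v)

theorem9 : (n : ℕ) → 2 ≤ n → (G : Graph n) →
    (4 ≤ gameBurningNumber G * gameBurningNumber (complement G))
    × (gameBurningNumber G * gameBurningNumber (complement G) ≤ 2 * n)
theorem9 n 2≤n G =
  ℕ.*-mono-≤ (2≤gameBurningNumber G 2≤n) (2≤gameBurningNumber G′ 2≤n) , upper
  where
  G′ : Graph n
  G′ = complement G
  upper : gameBurningNumber G * gameBurningNumber G′ ≤ 2 * n
  -- The graph with the larger maximum degree becomes the first graph of `product-≤`.
  upper with maximiser (fromℕ< 2≤n) (∣_∣ ∘ neighbours G)
           | maximiser (fromℕ< 2≤n) (∣_∣ ∘ neighbours G′)
  ... | v , max-v | v′ , max-v′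
    with ℕ.≤-total ∣ neighbours G′ v′ ∣ ∣ neighbours G v ∣
  ... | inj₁ v′≤v =
    product-≤ G G′ (covering-complement G) 2≤n (λ u → ℕ.≤-trans (max-v′ u) v′≤v)
  ... | inj₂ v≤v′ = subst (_≤ 2 * n) (ℕ.*-comm (gameBurningNumber G′) _)
    (product-≤ G′ G (swap ∘ covering-complement G) 2≤n (λ u → ℕ.≤-trans (max-v u) v≤v′))
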